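{- Let $d \ge 1$ and $t \ge 2$ be fixed integers, and let $H$ be a fixed $d$-uniform hypergraph with at least two edges such that $\operatorname{ex}_d(n, H) = O(n^{d-1})$. Then $\operatorname{ex}_{d+1}(n,K_{H,t}) = O(n^{d+1-1/t})$.
   Context: All hypergraphs are finite. A $d$-uniform hypergraph is one all of whose edges are $d$-element subsets of the vertex set (for $d=1$ the edges are singletons). A hypergraph is $H$-free if it contains no (not necessarily induced) subhypergraph isomorphic to $H$. For a $d$-uniform hypergraph $H$, $\operatorname{ex}_d(n,H)$ denotes the maximum number of edges in an $H$-free $d$-uniform hypergraph on $n$ vertices. For a $d$-uniform hypergraph $H$ and a positive integer $t$, $K_{H,t}$ is the $(d+1)$-uniform hypergraph obtained from $H$ by adding $t$ new vertices $v_1,\dots,v_t$ and replacing every edge $e \in E(H)$ with the $t$ edges $e\cup\{v_1\},\dots,e\cup\{v_t\}$. Asymptotic notation is as $n\to\infty$ with $d$, $t$, $H$ fixed; implied constants may depend on these fixed parameters. -}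

module Defs where

open import Data.Bool using (true; false)
open import Data.Bool.Properties using () renaming (_≟_ to _≟ᵇ_)
open import Data.Fin using (Fin; zero; suc)
import Data.Fin.Properties as Fin
open import Data.Fin.Subset using (Subset; inside; outside; _∈_; ∣_∣; ⁅_⁆)
open import Data.Fin.Subset.Properties using (_∈?_; x∈⁅x⁆; x∈⁅y⁆⇒x≡y)
open import Data.List using
  (List; []; _∷_; _++_; length; map; filter; allFin; cartesianProductWith)
open import Data.List.Extrema.Nat using (max; xs≤max; argmax-sel)
import Data.List.Membership.DecPropositional as DecMembership
open import Data.List.Membership.Propositional using () renaming (_∈_ to _∈ₗ_)
open import Data.List.Membership.Propositional.Properties using
  (∈-map⁺; ∈-map⁻; ∈-++⁺ˡ; ∈-++⁺ʳ; ∈-filter⁺; ∈-filter⁻)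
open import Data.List.Membership.Propositional.Properties.WithK using
  (unique∧set⇒bag)
open import Data.List.Relation.Binary.BagAndSetEquality using (∼bag⇒↭)
open import Data.List.Relation.Binary.Permutation.Propositional.Properties
  using (↭-length)
import Data.List.Relation.Unary.All as All
open import Data.List.Relation.Unary.All using (All)
import Data.List.Relation.Unary.AllPairs as AllPairs
open import Data.List.Relation.Unary.Any using (here; there)
open import Data.List.Relation.Unary.Unique.Propositional using (Unique)
import Data.List.Relation.Unary.Unique.Propositional.Properties as Unique
open import Data.Nat using (ℕ; zero; suc; _+_; _*_; _^_; _≤_; _≥_)
import Data.Nat.Properties as ℕ
open import Data.Product using (∃; ∃-syntax; _×_; _,_; proj₁; proj₂)
open import Data.Sum using (inj₁; inj₂)
import Data.Vec as Vec
import Data.Vec.Functional as F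
import Data.Vec.Properties as Vec
open import Function using (_∘_; id; _⇔_; mk⇔; Equivalence)
open import Function.Definitions using (Injective)
open import Relation.Binary.PropositionalEquality using
  (_≡_; _≗_; refl; sym; trans; subst)
open import Relation.Nullary using (Dec; does; ¬_)
open import Relation.Nullary.Decidable using
  (_×-dec_; ¬?; map′; does-⇔; _→-dec_)

private
  variable
    m n : ℕ

_≟ˢ_ : (e e′ : Subset n) → Dec (e ≡ e′)
_≟ˢ_ = Vec.≡-dec _≟ᵇ_

module _ {n : ℕ} where
  open DecMembership (_≟ˢ_ {n}) public using () renaming (_∈?_ to _∈ₗ?_)

-- The list is used only as a finite set of edges: no notion below depends
-- on its order, and `unique` makes its length the number of edges.
record Hypergraph (n : ℕ) : Set where
  field
    edges  : List (Subset n)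
    unique : Unique edges

open Hypergraph public

size : Hypergraph n → ℕ
size G = length (edges G)

Uniform : ℕ → Hypergraph n → Set
Uniform d G = All (λ e → ∣ e ∣ ≡ d) (edges G)

InImage : (Fin m → Fin n) → Subset m → Fin n → Set
InImage f e v = ∃[ u ] (u ∈ e × f u ≡ v)

inImage? : (f : Fin m → Fin n) (e : Subset m) (v : Fin n) → Dec (InImage f e v)
inImage? f e v = Fin.any? (λ u → (u ∈? e) ×-dec (f u Fin.≟ v))

image : (Fin m → Fin n) → Subset m → Subset n
image f e = Vec.tabulate (λ v → does (inImage? f e v))

-- A (not necessarily induced) copy of H in G is given by an injective map
-- of vertices carrying edges of H to edges of G.
IsEmbedding : Hypergraph m → Hypergraph n → (Fin m → Fin n) → Set
IsEmbedding H G f =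
  Injective _≡_ _≡_ f × All (λ e → image f e ∈ₗ edges G) (edges H)

Contains : Hypergraph n → Hypergraph m → Set
Contains G H = ∃ (IsEmbedding H G)

Free : Hypergraph m → Hypergraph n → Set
Free H G = ¬ Contains G H

-- A subset of Fin (m + t) is an old part followed by a new part, so
-- `e Vec.++ ⁅ i ⁆` is e ∪ {vᵢ}.
K : Hypergraph m → (t : ℕ) → Hypergraph (m + t)
K H t = record
  { edges  = cartesianProductWith extend (edges H) (allFin t)
  ; unique = Unique.cartesianProductWith⁺ extend extend-injective
               (unique H) (Unique.allFin⁺ t)
  }
  where
  extend : Subset _ → Fin t → Subset _
  extend e i = e Vec.++ ⁅ i ⁆

  extend-injective : ∀ {e i e′ i′} → extend e i ≡ extend e′ i′ → e ≡ e′ × i ≡ i′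
  extend-injective {e} {i} {e′} eq with Vec.++-injective e e′ eq
  ... | e≡e′ , s≡s′ = e≡e′ , x∈⁅y⁆⇒x≡y _ (subst (i ∈_) s≡s′ (x∈⁅x⁆ i))

anyFunction? : ∀ m {P : (Fin m → Fin n) → Set} →
               (∀ {f g} → f ≗ g → P f → P g) → (∀ f → Dec (P f)) → Dec (∃ P)
anyFunction? zero resp P? = map′ (F.[] ,_) (λ (_ , p) → resp (λ ()) p) (P? F.[])
anyFunction? (suc m) {P} resp P? = map′
  (λ (x , f , p) → x F.∷ f , p)
  (λ (g , p) → F.head g , F.tail g , resp (η g) p)
  (Fin.any? λ x → anyFunction? m {P ∘ (x F.∷_)}
     (λ f≗g → resp λ { zero → refl ; (suc i) → f≗g i })
     (λ f → P? (x F.∷ f)))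
  where
  η : (g : Fin (suc m) → Fin _) → g ≗ (F.head g F.∷ F.tail g)
  η g zero    = refl
  η g (suc i) = refl

image-cong : {f g : Fin m → Fin n} → f ≗ g → image f ≗ image g
image-cong {f = f} {g} f≗g e = Vec.tabulate-cong λ v →
  does-⇔ (mk⇔ (λ (u , u∈e , eq) → u , u∈e , trans (sym (f≗g u)) eq)
              (λ (u , u∈e , eq) → u , u∈e , trans (f≗g u) eq))
         (inImage? f e v) (inImage? g e v)

injective? : (f : Fin m → Fin n) → Dec (Injective _≡_ _≡_ f)
injective? f = map′ (λ inj {x} {y} → inj x y) (λ inj x y → inj {x} {y})
  (Fin.all? λ x → Fin.all? λ y → (f x Fin.≟ f y) →-dec (x Fin.≟ y))

isEmbedding? : (H : Hypergraph m) (G : Hypergraph n) (f : Fin m → Fin n) →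
               Dec (IsEmbedding H G f)
isEmbedding? H G f =
  injective? f ×-dec All.all? (λ e → image f e ∈ₗ? edges G) (edges H)

contains? : (G : Hypergraph n) (H : Hypergraph m) → Dec (Contains G H)
contains? G H = anyFunction? _ resp (isEmbedding? H G)
  where
  resp : ∀ {f g} → f ≗ g → IsEmbedding H G f → IsEmbedding H G g
  resp f≗g (inj , emb) =
    (λ {x} {y} eq → inj (trans (f≗g x) (trans eq (sym (f≗g y))))) ,
    All.map (λ {e} → subst (_∈ₗ edges G) (image-cong f≗g e)) emb

free? : (H : Hypergraph m) (G : Hypergraph n) → Dec (Free H G)
free? H G = ¬? (contains? G H)

uniform? : ∀ d (G : Hypergraph n) → Dec (Uniform d G)
uniform? d G = All.all? (λ e → ∣ e ∣ ℕ.≟ d) (edges G)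

subsets : ∀ n → List (Subset n)
subsets zero    = Vec.[] ∷ []
subsets (suc n) =
  map (inside Vec.∷_) (subsets n) ++ map (outside Vec.∷_) (subsets n)

subsets-unique : ∀ n → Unique (subsets n)
subsets-unique zero    = All.[] AllPairs.∷ AllPairs.[]
subsets-unique (suc n) = Unique.++⁺
  (Unique.map⁺ Vec.∷-injectiveʳ (subsets-unique n))
  (Unique.map⁺ Vec.∷-injectiveʳ (subsets-unique n))
  disjoint
  where
  disjoint : ∀ {e} → ¬ (e ∈ₗ map (inside Vec.∷_) (subsets n) ×
                        e ∈ₗ map (outside Vec.∷_) (subsets n))
  disjoint (p , q) with ∈-map⁻ (inside Vec.∷_) p | ∈-map⁻ (outside Vec.∷_) q
  ... | _ , _ , refl | _ , _ , ()

∈-subsets : (e : Subset n) → e ∈ₗ subsets n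
∈-subsets Vec.[]              = here refl
∈-subsets (inside  Vec.∷ e) = ∈-++⁺ˡ (∈-map⁺ (inside Vec.∷_) (∈-subsets e))
∈-subsets (outside Vec.∷ e) =
  ∈-++⁺ʳ (map (inside Vec.∷_) (subsets _)) (∈-map⁺ (outside Vec.∷_) (∈-subsets e))

sublists : {A : Set} → List A → List (List A)
sublists []       = [] ∷ []
sublists (x ∷ xs) = map (x ∷_) (sublists xs) ++ sublists xs

filter∈sublists : {A : Set} {P : A → Set} (P? : ∀ x → Dec (P x)) (xs : List A) →
                  filter P? xs ∈ₗ sublists xs
filter∈sublists P? []       = here refl
filter∈sublists P? (x ∷ xs) with does (P? x)
... | true  = ∈-++⁺ˡ (∈-map⁺ (x ∷_) (filter∈sublists P? xs))
... | false = ∈-++⁺ʳ (map (x ∷_) (sublists xs)) (filter∈sublists P? xs)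

fromEdges : List (Subset n) → Hypergraph n
fromEdges {n} E = record
  { edges  = filter (_∈ₗ? E) (subsets n)
  ; unique = Unique.filter⁺ (_∈ₗ? E) (subsets-unique n)
  }

hypergraphs : ∀ n → List (Hypergraph n)
hypergraphs n = map fromEdges (sublists (subsets n))

candidates : ℕ → Hypergraph m → ∀ n → List (Hypergraph n)
candidates d H n = filter (λ G → uniform? d G ×-dec free? H G) (hypergraphs n)

-- ex d H n is ex_d(n,H).  The default 0 matters only if no H-free
-- hypergraph on n vertices exists, which requires H to have no edges.
ex : ℕ → Hypergraph m → ℕ → ℕ
ex d H n = max 0 (map size (candidates d H n))

_≈_ : Hypergraph n → Hypergraph n → Set
G ≈ G′ = ∀ {e} → e ∈ₗ edges G ⇔ e ∈ₗ edges G′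

size-cong : {G G′ : Hypergraph n} → G ≈ G′ → size G ≡ size G′
size-cong {G = G} {G′} G≈G′ =
  ↭-length (∼bag⇒↭ (unique∧set⇒bag (unique G) (unique G′) G≈G′))

listed : (G : Hypergraph n) → ∃[ G′ ] (G′ ∈ₗ hypergraphs n × G ≈ G′)
listed {n} G = fromEdges E , ∈-map⁺ fromEdges (filter∈sublists (_∈ₗ? edges G) (subsets n)) ,
  mk⇔ (λ e∈G → ∈-filter⁺ (_∈ₗ? E) (∈-subsets _)
                     (∈-filter⁺ (_∈ₗ? edges G) (∈-subsets _) e∈G))
      (λ e∈G′ → proj₂ (∈-filter⁻ (_∈ₗ? edges G) {xs = subsets n}
                  (proj₂ (∈-filter⁻ (_∈ₗ? E) {xs = subsets n} e∈G′))))
  where E = filter (_∈ₗ? edges G) (subsets n)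

empty : Hypergraph n
empty = record { edges = [] ; unique = AllPairs.[] }

empty-free : (H : Hypergraph m) → 1 ≤ size H → Free H (empty {n})
empty-free record { edges = _ ∷ _ } _ (_ , _ , () All.∷ _)

-- The two lemmas below say that ex d H n is the maximum number of edges in
-- an H-free d-uniform hypergraph on n vertices.
ex-upper : ∀ d (H : Hypergraph m) (G : Hypergraph n) →
           Uniform d G → Free H G → size G ≤ ex d H n
ex-upper {n = n} d H G uni free with listed G
... | G′ , G′∈ , G≈G′ = subst (_≤ ex d H n) (sym (size-cong {G = G} {G′} G≈G′))
  (All.lookup (xs≤max 0 (map size (candidates d H n)))
    (∈-map⁺ size (∈-filter⁺ (λ G → uniform? d G ×-dec free? H G) G′∈ (uni′ , free′))))
  where
  uni′ : Uniform d G′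
  uni′ = All.tabulate (λ e∈ → All.lookup uni (Equivalence.from G≈G′ e∈))

  free′ : Free H G′
  free′ (f , inj , emb) =
    free (f , (λ {x} {y} → inj {x} {y}) , All.map (Equivalence.from G≈G′) emb)

ex-attained : ∀ d (H : Hypergraph m) n → 1 ≤ size H →
              ∃[ G ] (Uniform {n} d G × Free H G × size G ≡ ex d H n)
ex-attained d H n 1≤H with argmax-sel id 0 (map size (candidates d H n))
... | inj₁ ex≡0 = empty , All.[] , empty-free H 1≤H , sym ex≡0
... | inj₂ ex∈ with ∈-map⁻ size ex∈
...   | G , G∈ , ex≡
      with ∈-filter⁻ (λ G → uniform? d G ×-dec free? H G) {xs = hypergraphs n} G∈
...     | _ , uni , free = G , uni , free , sym ex≡

-- For q ≥ 1, f =O[n^ p / q ] says f(n) = O(n^(p/q)) as n → ∞: the bound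
-- f(n) ≤ C · n^(p/q) is raised to the power q, and the constant C may be
-- taken to be a natural number by rounding up.
_=O[n^_/_] : (ℕ → ℕ) → ℕ → ℕ → Set
f =O[n^ p / q ] = ∃[ C ] ∃[ n₀ ] (∀ n → n ≥ n₀ → f n ^ q ≤ C ^ q * n ^ p)

{-# OPTIONS --safe #-}
module Submission where

-- For a vertex tuple v = (v₁, …, vₜ) let ℓ(v) be the number of d-sets e such
-- that every e ∪ {vᵢ} is an edge of G.  Then Σᵥ ℓ(v) = Σₑ deg(e)^t, and the
-- power mean inequality over the at most n^d sets e bounds |E(G)|^t by
-- n^(d(t-1)) Σᵥ ℓ(v).  If the vᵢ are distinct, their common link restricted to
-- the other vertices is H-free, so ℓ(v) ≤ C n^(d-1); restricting it keeps an
-- isolated vertex of H from being embedded at some vᵢ.  The remaining tuples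
-- number at most (t-1)² n^(t-1), and ℓ(v) ≤ n^d for each of them.

open import Defs
open import Data.Nat using (ℕ; suc; _*_; _∸_; _≤_)
open import Data.Bool using (true; false; if_then_else_)
open import Data.Fin using (Fin; zero; suc; splitAt; join)
import Data.Fin.Properties as Fin
open import Data.Fin.Subset using (Subset; inside; outside; _∈_; ∣_∣; ⁅_⁆; _∪_)
open import Data.Fin.Subset.Properties
  using (_∈?_; x∈⁅x⁆; x∈⁅y⁆⇒x≡y; x∈p∪q⁺; x∈p∪q⁻; ⊆-antisym; ∪-identityʳ)
open import Data.List using
  (List; []; _∷_; _++_; length; map; filter; allFin; cartesianProduct;
   cartesianProductWith; tabulate)
import Data.List as List
open import Data.List.Properties using
  (map-++; map-∘; length-map; length-++; length-tabulate; length-filter; map-tabulate)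
open import Data.List.Membership.Propositional using () renaming (_∈_ to _∈ₗ_)
open import Data.List.Membership.Propositional.Properties using
  (∈-∃++; ∈-++⁺ˡ; ∈-++⁺ʳ; ∈-++⁻; ∈-map⁺; ∈-map⁻; ∈-filter⁺; ∈-filter⁻;
   ∈-allFin; ∈-lookup; ∈-cartesianProduct⁺; ∈-cartesianProductWith⁻; ∈-tabulate⁺)
open import Data.List.Relation.Unary.All as All using ([]; _∷_)
open import Data.List.Relation.Unary.AllPairs using ([]; _∷_)
import Data.List.Relation.Unary.Any as Any
open import Data.List.Relation.Unary.Any using (here; there)
open import Data.List.Relation.Unary.Any.Properties using (lookup-index)
open import Data.List.Relation.Unary.Unique.Propositional using (Unique)
import Data.List.Relation.Unary.Unique.Propositional.Properties as Unique
open import Data.Nat using (zero; _+_; _^_; z≤n; s≤s)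
open import Data.Nat.ListAction using (sum)
open import Data.Nat.ListAction.Properties using (sum-++)
open import Data.Nat.Properties hiding (_≟_)
import Data.Nat.Properties as ℕ
open import Data.Nat.Tactic.RingSolver using (solve-∀)
open import Data.Product using (∃-syntax; _×_; _,_; proj₁; proj₂; uncurry)
open import Data.Sum using (_⊎_; inj₁; inj₂; [_,_]′)
open import Data.Vec using (Vec)
import Data.Vec as Vec
import Data.Vec.Properties as Vec
import Data.Vec.Relation.Unary.All as VecAll
import Data.Vec.Relation.Unary.All.Properties as VecAll
import Data.Vec.Relation.Unary.AllPairs as VecAllPairs
import Data.Vec.Relation.Unary.Unique.Propositional as VecUnique
import Data.Vec.Relation.Unary.Unique.Propositional.Properties as VecUnique
open import Function using (_∘_; id)
open import Function.Definitions using (Injective)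
open import Relation.Binary.PropositionalEquality
open import Relation.Nullary using (Dec; yes; no; does; ¬_; contradiction)
open import Relation.Nullary.Decidable using (_×-dec_; ¬?; dec-true)

private
  variable
    m n : ℕ
    A B X : Set

-- Finite sums

∑ : List A → (A → ℕ) → ℕ
∑ xs f = sum (map f xs)

syntax ∑ xs (λ x → e) = ∑[ x ← xs ] e

∑-mono : ∀ {f g : A → ℕ} xs → (∀ {x} → x ∈ₗ xs → f x ≤ g x) → ∑ xs f ≤ ∑ xs g
∑-mono []       f≤g = z≤n
∑-mono (x ∷ xs) f≤g = +-mono-≤ (f≤g (here refl)) (∑-mono xs (f≤g ∘ there))

∑-cong : ∀ {f g : A → ℕ} xs → (∀ x → f x ≡ g x) → ∑ xs f ≡ ∑ xs g
∑-cong []       f≡g = refl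
∑-cong (x ∷ xs) f≡g = cong₂ _+_ (f≡g x) (∑-cong xs f≡g)

∑-const : ∀ (xs : List A) c → ∑[ _ ← xs ] c ≡ length xs * c
∑-const []       c = refl
∑-const (x ∷ xs) c = cong (c +_) (∑-const xs c)

∑-distrib-+ : ∀ (f g : A → ℕ) xs → ∑[ x ← xs ] (f x + g x) ≡ ∑ xs f + ∑ xs g
∑-distrib-+ f g []       = refl
∑-distrib-+ f g (x ∷ xs) = begin
  f x + g x + ∑[ y ← xs ] (f y + g y)  ≡⟨ cong (f x + g x +_) (∑-distrib-+ f g xs) ⟩
  f x + g x + (∑ xs f + ∑ xs g)        ≡⟨ interchange (f x) (g x) (∑ xs f) (∑ xs g) ⟩
  f x + ∑ xs f + (g x + ∑ xs g)        ∎
  where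
  open ≡-Reasoning
  interchange : ∀ a b c d → a + b + (c + d) ≡ a + c + (b + d)
  interchange = solve-∀

∑-*ˡ : ∀ c (f : A → ℕ) xs → c * ∑ xs f ≡ ∑[ x ← xs ] (c * f x)
∑-*ˡ c f []       = *-zeroʳ c
∑-*ˡ c f (x ∷ xs) = trans (*-distribˡ-+ c (f x) (∑ xs f)) (cong (c * f x +_) (∑-*ˡ c f xs))

∑-*ʳ : ∀ c (f : A → ℕ) xs → ∑ xs f * c ≡ ∑[ x ← xs ] (f x * c)
∑-*ʳ c f []       = refl
∑-*ʳ c f (x ∷ xs) = trans (*-distribʳ-+ c (f x) (∑ xs f)) (cong (f x * c +_) (∑-*ʳ c f xs))

∑-swap : ∀ (f : A → B → ℕ) xs ys →
         ∑[ x ← xs ] ∑[ y ← ys ] f x y ≡ ∑[ y ← ys ] ∑[ x ← xs ] f x y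
∑-swap f []       ys = sym (trans (∑-const ys 0) (*-zeroʳ (length ys)))
∑-swap f (x ∷ xs) ys = trans (cong (∑ ys (f x) +_) (∑-swap f xs ys))
                             (sym (∑-distrib-+ (f x) (λ y → ∑[ x′ ← xs ] f x′ y) ys))

∑-++ : ∀ (f : A → ℕ) xs ys → ∑ (xs ++ ys) f ≡ ∑ xs f + ∑ ys f
∑-++ f xs ys = trans (cong sum (map-++ f xs ys)) (sum-++ (map f xs) (map f ys))

∑-map : ∀ (f : B → ℕ) (g : A → B) xs → ∑ (map g xs) f ≡ ∑ xs (f ∘ g)
∑-map f g xs = cong sum (sym (map-∘ xs))

∑-cartesianProductWith : ∀ (f : X → ℕ) (g : A → B → X) xs ys →
  ∑ (cartesianProductWith g xs ys) f ≡ ∑[ x ← xs ] ∑[ y ← ys ] f (g x y)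
∑-cartesianProductWith f g []       ys = refl
∑-cartesianProductWith f g (x ∷ xs) ys = trans
  (∑-++ f (map (g x) ys) (cartesianProductWith g xs ys))
  (cong₂ _+_ (∑-map f (g x) ys) (∑-cartesianProductWith f g xs ys))

-- Indicators and counting

ind : {P : Set} → Dec P → ℕ
ind P? = if does P? then 1 else 0

ind-× : {P Q : Set} (P? : Dec P) (Q? : Dec Q) → ind (P? ×-dec Q?) ≡ ind P? * ind Q?
ind-× P? Q? with does P?
... | true  = sym (+-identityʳ (ind Q?))
... | false = refl

length-filter≡∑ : {P : A → Set} (P? : ∀ x → Dec (P x)) → ∀ xs →
                  length (filter P? xs) ≡ ∑[ x ← xs ] ind (P? x)
length-filter≡∑ P? []       = refl
length-filter≡∑ P? (x ∷ xs) with does (P? x)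
... | true  = cong suc (length-filter≡∑ P? xs)
... | false = length-filter≡∑ P? xs

-- Power means

rearrangement : ∀ {a b c d} → a ≤ b → c ≤ d → a * d + b * c ≤ a * c + b * d
rearrangement {a} {_} {c} a≤b c≤d
  with k , refl ← m≤n⇒∃[o]m+o≡n a≤b
     | l , refl ← m≤n⇒∃[o]m+o≡n c≤d =
  subst (a * (c + l) + (a + k) * c ≤_) (expand a k c l) (m≤m+n _ (k * l))
  where
  expand : ∀ a k c l → a * (c + l) + (a + k) * c + k * l ≡ a * c + (a + k) * (c + l)
  expand = solve-∀

-- `x` and `x ^ t` are ordered alike, so the two-term rearrangement inequality applies whichever of
-- `x` and `y` is larger.
rearrangement-^ : ∀ t x y → x * y ^ t + y * x ^ t ≤ x * x ^ t + y * y ^ t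
rearrangement-^ t x y with ≤-total x y
... | inj₁ x≤y = rearrangement x≤y (^-monoˡ-≤ t x≤y)
... | inj₂ y≤x = subst₂ _≤_ (+-comm (y * x ^ t) _) (+-comm (y * y ^ t) _)
                   (rearrangement y≤x (^-monoˡ-≤ t y≤x))

-- Chebyshev's sum inequality. Assuming similar ordering pair by pair, instead of sortedness, lets
-- induction on the list work: the products of head and tail are compared pair by pair in `cross`.
chebyshev : ∀ (f g : A → ℕ) →
            (∀ x y → f x * g y + f y * g x ≤ f x * g x + f y * g y) →
            ∀ xs → ∑ xs f * ∑ xs g ≤ length xs * ∑[ x ← xs ] (f x * g x)
chebyshev f g similar []       = z≤n
chebyshev f g similar (x ∷ xs) = begin
  (f x + F) * (g x + G)
    ≡⟨ expand (f x) F (g x) G ⟩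
  f x * g x + (f x * G + F * g x) + F * G
    ≤⟨ +-mono-≤ (+-monoʳ-≤ (f x * g x) (cross xs)) (chebyshev f g similar xs) ⟩
  f x * g x + (N * (f x * g x) + S) + N * S
    ≡⟨ collect (f x * g x) N S ⟩
  suc N * (f x * g x + S)
    ∎
  where
  open ≤-Reasoning
  F = ∑ xs f
  G = ∑ xs g
  N = length xs
  S = ∑[ y ← xs ] (f y * g y)

  expand : ∀ a F b G → (a + F) * (b + G) ≡ a * b + (a * G + F * b) + F * G
  expand = solve-∀

  collect : ∀ p N S → p + (N * p + S) + N * S ≡ suc N * (p + S)
  collect = solve-∀

  cross : ∀ ys → f x * ∑ ys g + ∑ ys f * g x ≤
                 length ys * (f x * g x) + ∑[ y ← ys ] (f y * g y)
  cross ys = begin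
    f x * ∑ ys g + ∑ ys f * g x
      ≡⟨ cong₂ _+_ (∑-*ˡ (f x) g ys) (∑-*ʳ (g x) f ys) ⟩
    ∑[ y ← ys ] (f x * g y) + ∑[ y ← ys ] (f y * g x)
      ≡⟨ ∑-distrib-+ _ _ ys ⟨
    ∑[ y ← ys ] (f x * g y + f y * g x)
      ≤⟨ ∑-mono ys (λ {y} _ → similar x y) ⟩
    ∑[ y ← ys ] (f x * g x + f y * g y)
      ≡⟨ ∑-distrib-+ _ _ ys ⟩
    ∑[ _ ← ys ] (f x * g x) + ∑[ y ← ys ] (f y * g y)
      ≡⟨ cong (_+ ∑[ y ← ys ] (f y * g y)) (∑-const ys (f x * g x)) ⟩
    length ys * (f x * g x) + ∑[ y ← ys ] (f y * g y)
      ∎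

-- Each further factor `∑ xs f` is absorbed by Chebyshev's inequality for `f` and its power
-- `f x ^ suc t`, at the cost of one factor `length xs`.
power-mean : ∀ t (f : A → ℕ) xs →
             ∑ xs f ^ suc t ≤ length xs ^ t * ∑[ x ← xs ] (f x ^ suc t)
power-mean zero f xs = ≤-reflexive (trans (*-identityʳ _) (sym (trans (+-identityʳ _)
  (∑-cong xs (λ x → *-identityʳ (f x))))))
power-mean (suc t) f xs = begin
  ∑ xs f * ∑ xs f ^ suc t
    ≤⟨ *-monoʳ-≤ (∑ xs f) (power-mean t f xs) ⟩
  ∑ xs f * (length xs ^ t * ∑[ x ← xs ] (f x ^ suc t))
    ≡⟨ reorder (∑ xs f) (length xs ^ t) _ ⟩
  length xs ^ t * (∑ xs f * ∑[ x ← xs ] (f x ^ suc t))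
    ≤⟨ *-monoʳ-≤ (length xs ^ t)
         (chebyshev f _ (λ x y → rearrangement-^ (suc t) (f x) (f y)) xs) ⟩
  length xs ^ t * (length xs * ∑[ x ← xs ] (f x ^ suc (suc t)))
    ≡⟨ reorder′ (length xs ^ t) (length xs) _ ⟩
  length xs ^ suc t * ∑[ x ← xs ] (f x ^ suc (suc t))
    ∎
  where
  open ≤-Reasoning
  reorder : ∀ a b c → a * (b * c) ≡ b * (a * c)
  reorder = solve-∀
  reorder′ : ∀ a b c → a * (b * c) ≡ b * a * c
  reorder′ = solve-∀

-- Tuples

tuples : ∀ t → List A → List (Vec A t)
tuples zero    xs = Vec.[] ∷ []
tuples (suc t) xs = cartesianProductWith Vec._∷_ xs (tuples t xs)

length-tuples : ∀ t (xs : List A) → length (tuples t xs) ≡ length xs ^ t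
length-tuples zero    xs = refl
length-tuples (suc t) xs = begin
  length (tuples (suc t) xs)               ≡⟨ length≡∑ (tuples (suc t) xs) ⟨
  ∑[ _ ← tuples (suc t) xs ] 1             ≡⟨ ∑-cartesianProductWith _ Vec._∷_ xs (tuples t xs) ⟩
  ∑[ _ ← xs ] ∑[ _ ← tuples t xs ] 1       ≡⟨ ∑-const xs _ ⟩
  length xs * ∑[ _ ← tuples t xs ] 1       ≡⟨ cong (length xs *_) (length≡∑ (tuples t xs)) ⟩
  length xs * length (tuples t xs)         ≡⟨ cong (length xs *_) (length-tuples t xs) ⟩
  length xs ^ suc t                        ∎
  where
  open ≡-Reasoning
  length≡∑ : ∀ {C : Set} (ys : List C) → ∑[ _ ← ys ] 1 ≡ length ys
  length≡∑ ys = trans (∑-const ys 1) (*-identityʳ (length ys))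

-- Multiplying out the power gives one product of indicators per tuple, and that product is the
-- indicator of all entries satisfying `P`.
count-^ : {P : A → Set} (P? : ∀ x → Dec (P x)) → ∀ t xs →
          (∑[ x ← xs ] ind (P? x)) ^ t ≡ ∑[ v ← tuples t xs ] ind (VecAll.all? P? v)
count-^ P? zero    xs = refl
count-^ P? (suc t) xs = begin
  S * S ^ t
    ≡⟨ cong (S *_) (count-^ P? t xs) ⟩
  S * ∑[ v ← tuples t xs ] ind (VecAll.all? P? v)
    ≡⟨ ∑-*ʳ _ (λ x → ind (P? x)) xs ⟩
  ∑[ x ← xs ] (ind (P? x) * ∑[ v ← tuples t xs ] ind (VecAll.all? P? v))
    ≡⟨ ∑-cong xs (λ x → trans (∑-*ˡ (ind (P? x)) _ (tuples t xs))
         (∑-cong (tuples t xs) (λ v → sym (ind-× (P? x) (VecAll.all? P? v))))) ⟩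
  ∑[ x ← xs ] ∑[ v ← tuples t xs ] ind (VecAll.all? P? (x Vec.∷ v))
    ≡⟨ ∑-cartesianProductWith _ Vec._∷_ xs (tuples t xs) ⟨
  ∑[ v ← tuples (suc t) xs ] ind (VecAll.all? P? v)
    ∎
  where
  open ≡-Reasoning
  S = ∑[ x ← xs ] ind (P? x)

-- Double counting of pairs of an `e` and a tuple of neighbours of `e`: by `count-^`,
-- `deg e ^ suc t` counts the tuples for fixed `e`, and exchanging the sums counts the common
-- neighbours of each tuple.
incidences-^ : {R : B → A → Set} (R? : ∀ e x → Dec (R e x)) → ∀ t es xs →
  (∑[ e ← es ] ∑[ x ← xs ] ind (R? e x)) ^ suc t ≤
  length es ^ t *
    ∑[ v ← tuples (suc t) xs ] length (filter (λ e → VecAll.all? (R? e) v) es)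
incidences-^ R? t es xs = begin
  (∑[ e ← es ] deg e) ^ suc t
    ≤⟨ power-mean t deg es ⟩
  length es ^ t * ∑[ e ← es ] (deg e ^ suc t)
    ≡⟨ cong (length es ^ t *_) (∑-cong es (λ e → count-^ (R? e) (suc t) xs)) ⟩
  length es ^ t * ∑[ e ← es ] ∑[ v ← tuples (suc t) xs ] ind (VecAll.all? (R? e) v)
    ≡⟨ cong (length es ^ t *_) (∑-swap _ es (tuples (suc t) xs)) ⟩
  length es ^ t * ∑[ v ← tuples (suc t) xs ] ∑[ e ← es ] ind (VecAll.all? (R? e) v)
    ≡⟨ cong (length es ^ t *_) (∑-cong (tuples (suc t) xs)
         (λ v → sym (length-filter≡∑ (λ e → VecAll.all? (R? e) v) es))) ⟩
  length es ^ t *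
    ∑[ v ← tuples (suc t) xs ] length (filter (λ e → VecAll.all? (R? e) v) es)
    ∎
  where
  open ≤-Reasoning
  deg = λ e → ∑[ x ← xs ] ind (R? e x)

-- Lists without repetition

-- Cutting the head of `xs` out of `ys` leaves a list that still contains the tail of `xs`, since
-- the head does not recur there.
unique-⊆⇒length≤ : {xs ys : List A} → Unique xs →
                   (∀ {x} → x ∈ₗ xs → x ∈ₗ ys) → length xs ≤ length ys
unique-⊆⇒length≤ []             xs⊆ys = z≤n
unique-⊆⇒length≤ {xs = x ∷ xs} (x∉ ∷ u) xs⊆ys
  with as , bs , refl ← ∈-∃++ (xs⊆ys (here refl)) = begin
  suc (length xs)               ≤⟨ s≤s (unique-⊆⇒length≤ u xs⊆as++bs) ⟩
  suc (length (as ++ bs))       ≡⟨ cong suc (length-++ as) ⟩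
  suc (length as + length bs)   ≡⟨ +-suc (length as) (length bs) ⟨
  length as + suc (length bs)   ≡⟨ length-++ as ⟨
  length (as ++ x ∷ bs)         ∎
  where
  open ≤-Reasoning
  xs⊆as++bs : ∀ {y} → y ∈ₗ xs → y ∈ₗ as ++ bs
  xs⊆as++bs y∈ with ∈-++⁻ as (xs⊆ys (there y∈))
  ... | inj₁ y∈as         = ∈-++⁺ˡ y∈as
  ... | inj₂ (here refl)  = contradiction refl (All.lookup x∉ y∈)
  ... | inj₂ (there y∈bs) = ∈-++⁺ʳ as y∈bs

unique⇒lookup-injective : {xs : List A} → Unique xs → Injective _≡_ _≡_ (List.lookup xs)
unique⇒lookup-injective (x∉ ∷ u) {zero}  {zero}  eq = refl
unique⇒lookup-injective (x∉ ∷ u) {zero}  {suc j} eq = contradiction eq (All.lookup x∉ (∈-lookup j))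
unique⇒lookup-injective (x∉ ∷ u) {suc i} {zero}  eq = contradiction (sym eq) (All.lookup x∉ (∈-lookup i))
unique⇒lookup-injective (x∉ ∷ u) {suc i} {suc j} eq = cong suc (unique⇒lookup-injective u eq)

length-allFin : ∀ n → length (allFin n) ≡ n
length-allFin n = length-tabulate id

-- Repeated entries of tuples

hits : ∀ {t} → Fin n → Vec (Fin n) t → ℕ
hits x Vec.[]      = 0
hits x (y Vec.∷ v) = ind (x Fin.≟ y) + hits x v

-- The number of pairs of positions with equal entries. As a number rather than a predicate, it can
-- serve as a coefficient in `commonLink-bound` and be summed over all tuples.
repeats : ∀ {t} → Vec (Fin n) t → ℕ
repeats Vec.[]      = 0
repeats (x Vec.∷ v) = hits x v + repeats v

hits≡0⇒≢ : ∀ {t} (x : Fin n) (v : Vec (Fin n) t) → hits x v ≡ 0 → VecAll.All (x ≢_) v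
hits≡0⇒≢ x Vec.[]      eq = VecAll.[]
hits≡0⇒≢ x (y Vec.∷ v) eq with x Fin.≟ y
... | no x≢y = x≢y VecAll.∷ hits≡0⇒≢ x v eq

repeats≡0⇒unique : ∀ {t} (v : Vec (Fin n) t) → repeats v ≡ 0 → VecUnique.Unique v
repeats≡0⇒unique Vec.[]      eq = VecAllPairs.[]
repeats≡0⇒unique (x Vec.∷ v) eq =
  hits≡0⇒≢ x v (m+n≡0⇒m≡0 (hits x v) eq) VecAllPairs.∷
  repeats≡0⇒unique v (m+n≡0⇒n≡0 (hits x v) eq)

-- Each entry of `v` is hit by a single `x`: the duplicate-free list of such `x` is contained in a
-- one-element list.
∑-hits : ∀ {t} (v : Vec (Fin n) t) → ∑[ x ← allFin n ] hits x v ≤ t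
∑-hits {n} Vec.[] = ≤-reflexive (trans (∑-const (allFin n) 0) (*-zeroʳ (length (allFin n))))
∑-hits {n} {suc t} (y Vec.∷ v) = begin
  ∑[ x ← allFin n ] (ind (x Fin.≟ y) + hits x v)
    ≡⟨ ∑-distrib-+ _ _ (allFin n) ⟩
  ∑[ x ← allFin n ] ind (x Fin.≟ y) + ∑[ x ← allFin n ] hits x v
    ≤⟨ +-mono-≤ one (∑-hits v) ⟩
  1 + t
    ∎
  where
  open ≤-Reasoning
  one : ∑[ x ← allFin n ] ind (x Fin.≟ y) ≤ 1
  one = subst (_≤ 1) (length-filter≡∑ (Fin._≟ y) (allFin n))
    (unique-⊆⇒length≤ {ys = y ∷ []} (Unique.filter⁺ (Fin._≟ y) (Unique.allFin⁺ n))
      (λ x∈ → here (proj₂ (∈-filter⁻ (Fin._≟ y) {xs = allFin n} x∈))))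

-- Each pair of positions agrees in `n ^ t` tuples. There are t(t+1)/2 pairs, for which `t * t` is a
-- convenient upper bound.
∑-repeats : ∀ n t → ∑ (tuples (suc t) (allFin n)) repeats ≤ t * t * n ^ t
∑-repeats n zero = ≤-reflexive (begin
  ∑ (tuples 1 (allFin n)) repeats  ≡⟨ ∑-cartesianProductWith _ Vec._∷_ (allFin n) _ ⟩
  ∑[ _ ← allFin n ] 0              ≡⟨ ∑-const (allFin n) 0 ⟩
  length (allFin n) * 0            ≡⟨ *-zeroʳ (length (allFin n)) ⟩
  0                                ∎)
  where open ≡-Reasoning
∑-repeats n (suc t) = begin
  ∑ (tuples (suc (suc t)) V) repeats
    ≡⟨ ∑-cartesianProductWith _ Vec._∷_ V T ⟩
  ∑[ x ← V ] ∑[ v ← T ] (hits x v + repeats v)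
    ≡⟨ ∑-cong V (λ x → ∑-distrib-+ (hits x) repeats T) ⟩
  ∑[ x ← V ] (∑[ v ← T ] hits x v + ∑ T repeats)
    ≡⟨ ∑-distrib-+ _ _ V ⟩
  ∑[ x ← V ] ∑[ v ← T ] hits x v + ∑[ _ ← V ] ∑ T repeats
    ≡⟨ cong₂ _+_ (∑-swap hits V T) (∑-const V (∑ T repeats)) ⟩
  ∑[ v ← T ] ∑[ x ← V ] hits x v + length V * ∑ T repeats
    ≤⟨ +-mono-≤ (∑-mono T (λ {v} _ → ∑-hits v)) (*-mono-≤ (≤-reflexive (length-allFin n)) (∑-repeats n t)) ⟩
  ∑[ _ ← T ] suc t + n * (t * t * n ^ t)
    ≡⟨ cong (_+ n * (t * t * n ^ t)) (trans (∑-const T (suc t)) (cong (_* suc t)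
         (trans (length-tuples (suc t) V) (cong (_^ suc t) (length-allFin n))))) ⟩
  n ^ suc t * suc t + n * (t * t * n ^ t)
    -- The induction yields the coefficient t² + t + 1; adding t more completes the square.
    ≤⟨ m≤m+n _ (t * n ^ suc t) ⟩
  n ^ suc t * suc t + n * (t * t * n ^ t) + t * n ^ suc t
    ≡⟨ collect n (n ^ t) t ⟩
  suc t * suc t * n ^ suc t
    ∎
  where
  open ≤-Reasoning
  V = allFin n
  T = tuples (suc t) V
  collect : ∀ n p t → n * p * suc t + n * (t * t * p) + t * (n * p) ≡ suc t * suc t * (n * p)
  collect = solve-∀

-- Subsets of a finite set

layer : ℕ → ∀ n → List (Subset n)
layer d n = filter (λ e → ∣ e ∣ ℕ.≟ d) (subsets n)

-- Induction along Pascal's rule; the step is n^d + n · n^d = (n+1) n^d ≤ (n+1)^(d+1).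
length-layer : ∀ d n → length (layer d n) ≤ n ^ d
length-layer d n = subst (_≤ n ^ d) (sym (length-filter≡∑ (λ e → ∣ e ∣ ℕ.≟ d) (subsets n))) (count d n)
  where
  open ≤-Reasoning

  S : ℕ → ℕ → ℕ
  S d n = ∑[ e ← subsets n ] ind (∣ e ∣ ℕ.≟ d)

  split : ∀ d n → S d (suc n) ≡ ∑[ e ← subsets n ] ind (suc ∣ e ∣ ℕ.≟ d) + S d n
  split d n = trans
    (∑-++ _ (map (inside Vec.∷_) (subsets n)) (map (outside Vec.∷_) (subsets n)))
    (cong₂ _+_ (∑-map _ (inside Vec.∷_) (subsets n)) (∑-map _ (outside Vec.∷_) (subsets n)))

  count : ∀ d n → S d n ≤ n ^ d
  count zero    zero    = s≤s z≤n
  count (suc d) zero    = z≤n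
  count zero    (suc n) = begin
    S 0 (suc n)                       ≡⟨ split 0 n ⟩
    ∑[ _ ← subsets n ] 0 + S 0 n      ≡⟨ cong (_+ S 0 n) (∑-const (subsets n) 0) ⟩
    length (subsets n) * 0 + S 0 n    ≡⟨ cong (_+ S 0 n) (*-zeroʳ (length (subsets n))) ⟩
    S 0 n                             ≤⟨ count zero n ⟩
    1                                 ∎
  count (suc d) (suc n) = begin
    S (suc d) (suc n)                 ≡⟨ split (suc d) n ⟩
    S d n + S (suc d) n               ≤⟨ +-mono-≤ (count d n) (count (suc d) n) ⟩
    n ^ d + n * n ^ d                 ≤⟨ *-monoʳ-≤ (suc n) (^-monoˡ-≤ d (n≤1+n n)) ⟩
    suc n ^ suc d                     ∎

-- Elements and images of subsets

members : Subset n → List (Fin n)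
members p = filter (_∈? p) (allFin _)

length-members : ∀ (p : Subset n) → length (members p) ≡ ∣ p ∣
length-members p = trans (length-filter≡∑ (_∈? p) (allFin _)) (count p)
  where
  open ≡-Reasoning
  count : ∀ {n} (p : Subset n) → ∑[ x ← allFin n ] ind (x ∈? p) ≡ ∣ p ∣
  count Vec.[] = refl
  count {suc n} (s Vec.∷ p) = begin
    ind (zero ∈? s Vec.∷ p) + ∑[ x ← tabulate suc ] ind (x ∈? s Vec.∷ p)
      ≡⟨ cong (λ xs → ind (zero ∈? s Vec.∷ p) + ∑[ x ← xs ] ind (x ∈? s Vec.∷ p)) (map-tabulate id suc) ⟨
    ind (zero ∈? s Vec.∷ p) + ∑[ x ← map suc (allFin n) ] ind (x ∈? s Vec.∷ p)
      ≡⟨ cong (ind (zero ∈? s Vec.∷ p) +_) (∑-map _ suc (allFin n)) ⟩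
    ind (zero ∈? s Vec.∷ p) + ∑[ x ← allFin n ] ind (x ∈? p)
      ≡⟨ cong (ind (zero ∈? s Vec.∷ p) +_) (count p) ⟩
    ind (zero ∈? s Vec.∷ p) + ∣ p ∣
      ≡⟨ head s ⟩
    ∣ s Vec.∷ p ∣
      ∎
    where
    head : ∀ s → ind (zero ∈? s Vec.∷ p) + ∣ p ∣ ≡ ∣ s Vec.∷ p ∣
    head inside  = refl
    head outside = refl

∈-image⁺ : ∀ (f : Fin m → Fin n) {p u} → u ∈ p → f u ∈ image f p
∈-image⁺ f {p} {u} u∈p = Vec.lookup⇒[]= (f u) (image f p)
  (trans (Vec.lookup∘tabulate _ (f u)) (dec-true (inImage? f p (f u)) (u , u∈p , refl)))

∈-image⁻ : ∀ (f : Fin m → Fin n) {p v} → v ∈ image f p → InImage f p v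
∈-image⁻ f {p} {v} v∈
  with inImage? f p v | trans (sym (Vec.lookup∘tabulate (λ v → does (inImage? f p v)) v)) (Vec.[]=⇒lookup v∈)
... | yes inImage | _  = inImage
... | no _        | ()

-- Cardinalities are lengths of the duplicate-free lists `members`, and these lists are compared by
-- inclusion in both directions; injectivity keeps `map f (members p)` free of duplicates.
∣image∣ : ∀ (f : Fin m → Fin n) → Injective _≡_ _≡_ f → ∀ p → ∣ image f p ∣ ≡ ∣ p ∣
∣image∣ f inj p = ≤-antisym
  (subst₂ _≤_ (length-members (image f p)) length-map-members
    (unique-⊆⇒length≤ (Unique.filter⁺ (_∈? image f p) (Unique.allFin⁺ _)) to))
  (subst₂ _≤_ length-map-members (length-members (image f p))
    (unique-⊆⇒length≤ (Unique.map⁺ inj (Unique.filter⁺ (_∈? p) (Unique.allFin⁺ _))) from))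
  where
  length-map-members : length (map f (members p)) ≡ ∣ p ∣
  length-map-members = trans (length-map f (members p)) (length-members p)

  to : ∀ {v} → v ∈ₗ members (image f p) → v ∈ₗ map f (members p)
  to v∈ with ∈-image⁻ f (proj₂ (∈-filter⁻ (_∈? image f p) {xs = allFin _} v∈))
  ... | u , u∈p , refl = ∈-map⁺ f (∈-filter⁺ (_∈? p) (∈-allFin u) u∈p)

  from : ∀ {v} → v ∈ₗ map f (members p) → v ∈ₗ members (image f p)
  from v∈ with ∈-map⁻ f v∈
  ... | u , u∈ , refl = ∈-filter⁺ (_∈? image f p) (∈-allFin (f u))
    (∈-image⁺ f (proj₂ (∈-filter⁻ (_∈? p) {xs = allFin _} u∈)))

x∈p⇒p∪⁅x⁆≡p : ∀ {p : Subset n} {x} → x ∈ p → p ∪ ⁅ x ⁆ ≡ p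
x∈p⇒p∪⁅x⁆≡p {p = p} {x} x∈p = ⊆-antisym
  (λ y∈ → [ id , (λ y∈x → subst (_∈ p) (sym (x∈⁅y⁆⇒x≡y x y∈x)) x∈p) ]′ (x∈p∪q⁻ p ⁅ x ⁆ y∈))
  (λ y∈p → x∈p∪q⁺ (inj₁ y∈p))

delete : ∀ {d} (p : Subset n) → ∣ p ∣ ≡ suc d →
         ∃[ q ] ∃[ x ] (∣ q ∣ ≡ d × q ∪ ⁅ x ⁆ ≡ p)
delete (inside  Vec.∷ p) eq =
  outside Vec.∷ p , zero , suc-injective eq , cong (inside Vec.∷_) (∪-identityʳ p)
delete (outside Vec.∷ p) eq with delete p eq
... | q , x , ∣q∣≡d , q∪x≡p = outside Vec.∷ q , suc x , ∣q∣≡d , cong (outside Vec.∷_) q∪x≡p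

-- Enumerating the complement of a tuple

-- `ex` speaks of the vertex sets `Fin k`, so the vertices off the tuple are renumbered by `σ`. As
-- entries of `v` may coincide, `order` is only pinned between n - t and n: the lower bound keeps it
-- above the threshold of the hypothesis on `ex`, the upper one turns its powers into powers of n.
record Complement {t} (v : Fin t → Fin n) : Set where
  field
    order      : ℕ
    order≤n    : order ≤ n
    n≤order+t  : n ≤ order + t
    σ          : Fin order → Fin n
    σ-injective : Injective _≡_ _≡_ σ
    σ-avoids   : ∀ u i → σ u ≢ v i
    σ-covers   : ∀ x → (∃[ i ] v i ≡ x) ⊎ (∃[ u ] σ u ≡ x)

complement : ∀ {t} (v : Fin t → Fin n) → Complement v
complement {n} {t} v = record
  { order       = length outer
  ; order≤n     = subst (length outer ≤_) (length-allFin n) (length-filter new? (allFin n))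
  ; n≤order+t   = begin
      n                                ≡⟨ length-allFin n ⟨
      length (allFin n)                ≤⟨ unique-⊆⇒length≤ (Unique.allFin⁺ n) (λ {x} _ → split x) ⟩
      length (outer ++ tabulate v)     ≡⟨ length-++ outer ⟩
      length outer + length (tabulate v) ≡⟨ cong (length outer +_) (length-tabulate v) ⟩
      length outer + t                 ∎
  ; σ           = List.lookup outer
  ; σ-injective = unique⇒lookup-injective (Unique.filter⁺ new? (Unique.allFin⁺ n))
  ; σ-avoids    = λ u i eq →
      proj₂ (∈-filter⁻ new? {xs = allFin n} (∈-lookup {xs = outer} u)) (i , sym eq)
  ; σ-covers    = λ x → covers x (old? x)
  }
  where
  open ≤-Reasoning

  old? : ∀ x → Dec (∃[ i ] v i ≡ x)
  old? x = Fin.any? (λ i → v i Fin.≟ x)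

  new? : ∀ x → Dec (¬ (∃[ i ] v i ≡ x))
  new? x = ¬? (old? x)

  outer : List (Fin n)
  outer = filter new? (allFin n)

  covers : ∀ x → Dec (∃[ i ] v i ≡ x) → (∃[ i ] v i ≡ x) ⊎ (∃[ u ] List.lookup outer u ≡ x)
  covers x (yes old) = inj₁ old
  covers x (no new)  = inj₂ (Any.index x∈ , sym (lookup-index x∈))
    where x∈ = ∈-filter⁺ new? (∈-allFin x) new

  split : ∀ x → x ∈ₗ outer ++ tabulate v
  split x with covers x (old? x)
  ... | inj₁ (i , refl) = ∈-++⁺ʳ outer (∈-tabulate⁺ i)
  ... | inj₂ (u , refl) = ∈-++⁺ˡ (∈-lookup {xs = outer} u)

-- Preimages of subsets

preimage : (Fin m → Fin n) → Subset n → Subset m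
preimage f p = Vec.tabulate (λ u → Vec.lookup p (f u))

∈-preimage⁺ : ∀ (f : Fin m → Fin n) {p u} → f u ∈ p → u ∈ preimage f p
∈-preimage⁺ f {p} {u} fu∈p = Vec.lookup⇒[]= u _
  (trans (Vec.lookup∘tabulate _ u) (Vec.[]=⇒lookup fu∈p))

∈-preimage⁻ : ∀ (f : Fin m → Fin n) {p u} → u ∈ preimage f p → f u ∈ p
∈-preimage⁻ f {p} {u} u∈ = Vec.lookup⇒[]= (f u) p
  (trans (sym (Vec.lookup∘tabulate _ u)) (Vec.[]=⇒lookup u∈))

image-preimage : ∀ (f : Fin m → Fin n) {p} → (∀ {x} → x ∈ p → ∃[ u ] f u ≡ x) →
                 image f (preimage f p) ≡ p
image-preimage f {p} covered = ⊆-antisym to from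
  where
  to : ∀ {x} → x ∈ image f (preimage f p) → x ∈ p
  to x∈ with ∈-image⁻ f x∈
  ... | u , u∈ , refl = ∈-preimage⁻ f u∈

  from : ∀ {x} → x ∈ p → x ∈ image f (preimage f p)
  from x∈p with covered x∈p
  ... | u , refl = ∈-image⁺ f (∈-preimage⁺ f x∈p)

-- Common links

-- For `x` in `e` the union is `e` itself, which has too few elements to be an edge when `e` is a
-- d-set and `G` is (d+1)-uniform.
Completes : Hypergraph n → Subset n → Fin n → Set
Completes G e x = e ∪ ⁅ x ⁆ ∈ₗ edges G

completes? : ∀ (G : Hypergraph n) e x → Dec (Completes G e x)
completes? G e x = (e ∪ ⁅ x ⁆) ∈ₗ? edges G

commonLink : ∀ {t} → Hypergraph n → ℕ → Vec (Fin n) t → List (Subset n)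
commonLink {n} G d v = filter (λ e → VecAll.all? (completes? G e) v) (layer d n)

-- Deleting one vertex `x` from an edge leaves a d-set completed by `x`, so the map sending
-- `(e , x)` to `e ∪ ⁅ x ⁆` reaches every edge from some incident pair.
size≤incidences : ∀ (G : Hypergraph n) d → Uniform (suc d) G →
  size G ≤ ∑[ e ← layer d n ] ∑[ x ← allFin n ] ind (completes? G e x)
size≤incidences {n} G d uni = begin
  size G
    ≤⟨ unique-⊆⇒length≤ (unique G) covered ⟩
  length (map (uncurry add) (filter completesPair? pairs))
    ≡⟨ length-map (uncurry add) (filter completesPair? pairs) ⟩
  length (filter completesPair? pairs)
    ≡⟨ length-filter≡∑ completesPair? pairs ⟩
  ∑[ p ← pairs ] ind (completesPair? p)
    ≡⟨ ∑-cartesianProductWith _ _,_ (layer d n) (allFin n) ⟩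
  ∑[ e ← layer d n ] ∑[ x ← allFin n ] ind (completes? G e x)
    ∎
  where
  open ≤-Reasoning
  pairs = cartesianProduct (layer d n) (allFin n)

  add : Subset n → Fin n → Subset n
  add e x = e ∪ ⁅ x ⁆

  completesPair? : ∀ p → Dec (uncurry (Completes G) p)
  completesPair? (e , x) = completes? G e x

  covered : ∀ {g} → g ∈ₗ edges G → g ∈ₗ map (uncurry add) (filter completesPair? pairs)
  covered {g} g∈G with delete g (All.lookup uni g∈G)
  ... | e , x , ∣e∣≡d , refl = ∈-map⁺ (uncurry add) (∈-filter⁺ completesPair?
    (∈-cartesianProduct⁺ (∈-filter⁺ (λ e → ∣ e ∣ ℕ.≟ d) (∈-subsets e) ∣e∣≡d) (∈-allFin x))
    g∈G)

-- The common link as a hypergraph off the tuple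

module _ {n t} (G : Hypergraph n) (d : ℕ) (v : Vec (Fin n) t)
         (C : Complement (Vec.lookup v)) where
  open Complement C

  InLink : Subset order → Set
  InLink e = image σ e ∈ₗ commonLink G d v

  inLink? : ∀ e → Dec (InLink e)
  inLink? e = image σ e ∈ₗ? commonLink G d v

  linkHypergraph : Hypergraph order
  linkHypergraph = record
    { edges  = filter inLink? (subsets order)
    ; unique = Unique.filter⁺ inLink? (subsets-unique order)
    }

  private
    ∈-link⁻ : ∀ {e} → e ∈ₗ edges linkHypergraph →
              ∣ image σ e ∣ ≡ d × VecAll.All (Completes G (image σ e)) v
    ∈-link⁻ {e} e∈
      with ∈-filter⁻ (λ e → VecAll.all? (completes? G e) v) {xs = layer d n}
             (proj₂ (∈-filter⁻ inLink? {xs = subsets order} e∈))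
    ... | e∈layer , all = proj₂ (∈-filter⁻ (λ e → ∣ e ∣ ℕ.≟ d) {xs = subsets n} e∈layer) , all

  link-uniform : Uniform d linkHypergraph
  link-uniform = All.tabulate λ {e} e∈ →
    trans (sym (∣image∣ σ σ-injective e)) (proj₁ (∈-link⁻ e∈))

  -- Restricting to the complement loses nothing: members of the common link avoid the tuple, hence
  -- lie in the range of `σ` and are images of their preimages.
  length-commonLink≤size : Uniform (suc d) G →
                           length (commonLink G d v) ≤ size linkHypergraph
  length-commonLink≤size uni = subst (length (commonLink G d v) ≤_)
    (length-map (image σ) (edges linkHypergraph))
    (unique-⊆⇒length≤
      (Unique.filter⁺ (λ e → VecAll.all? (completes? G e) v)
        (Unique.filter⁺ (λ e → ∣ e ∣ ℕ.≟ d) (subsets-unique n)))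
      pull)
    where
    covered : ∀ {e x} → e ∈ₗ commonLink G d v → x ∈ e → ∃[ u ] σ u ≡ x
    covered {e} {x} e∈ x∈e with σ-covers x
    ... | inj₂ found      = found
    ... | inj₁ (i , refl)
          with ∈-filter⁻ (λ e → VecAll.all? (completes? G e) v) {xs = layer d n} e∈
    ...   | e∈layer , all =
      -- If an entry of the tuple lay in `e`, adding it would leave `e` unchanged, making `e` an
      -- edge with d instead of d + 1 elements.
      contradiction (trans (sym (All.lookup uni e∈G)) ∣e∣≡d) 1+n≢n
      where
      e∈G : e ∈ₗ edges G
      e∈G = subst (_∈ₗ edges G) (x∈p⇒p∪⁅x⁆≡p x∈e) (VecAll.lookup⁺ all i)

      ∣e∣≡d : ∣ e ∣ ≡ d
      ∣e∣≡d = proj₂ (∈-filter⁻ (λ e → ∣ e ∣ ℕ.≟ d) {xs = subsets n} e∈layer)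

    pull : ∀ {e} → e ∈ₗ commonLink G d v → e ∈ₗ map (image σ) (edges linkHypergraph)
    pull {e} e∈ = subst (_∈ₗ map (image σ) (edges linkHypergraph)) e≡
      (∈-map⁺ (image σ) (∈-filter⁺ inLink? (∈-subsets (preimage σ e))
        (subst (_∈ₗ commonLink G d v) (sym e≡) e∈)))
      where e≡ = image-preimage σ (covered e∈)

  -- A copy of `H` in the link extends to a copy of `K H t` in `G` by sending the i-th new vertex to
  -- the i-th entry of `v`. The two parts do not collide because `σ` avoids `v`, and the new
  -- vertices stay apart because the entries are distinct.
  link-free : VecUnique.Unique v → {H : Hypergraph m} → Free (K H t) G → Free H linkHypergraph
  link-free {m} v-unique {H} free (f , f-injective , f-edges) =
    free (F , F-injective , All.tabulate F-edges)
    where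
    g : Fin m ⊎ Fin t → Fin n
    g = [ σ ∘ f , Vec.lookup v ]′

    F : Fin (m + t) → Fin n
    F = g ∘ splitAt m

    g-injective : Injective _≡_ _≡_ g
    g-injective {inj₁ x} {inj₁ y} eq = cong inj₁ (f-injective (σ-injective eq))
    g-injective {inj₁ x} {inj₂ j} eq = contradiction eq (σ-avoids (f x) j)
    g-injective {inj₂ i} {inj₁ y} eq = contradiction (sym eq) (σ-avoids (f y) i)
    g-injective {inj₂ i} {inj₂ j} eq = cong inj₂ (VecUnique.lookup-injective v-unique i j eq)

    F-injective : Injective _≡_ _≡_ F
    F-injective {x} {y} eq = begin
      x                      ≡⟨ Fin.join-splitAt m t x ⟨
      join m t (splitAt m x) ≡⟨ cong (join m t) (g-injective {splitAt m x} {splitAt m y} eq) ⟩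
      join m t (splitAt m y) ≡⟨ Fin.join-splitAt m t y ⟩
      y                      ∎
      where open ≡-Reasoning

    image-F : ∀ h i → image F (h Vec.++ ⁅ i ⁆) ≡ image σ (image f h) ∪ ⁅ Vec.lookup v i ⁆
    image-F h i = ⊆-antisym to from
      where
      to : ∀ {x} → x ∈ image F (h Vec.++ ⁅ i ⁆) → x ∈ image σ (image f h) ∪ ⁅ Vec.lookup v i ⁆
      to x∈ with ∈-image⁻ F x∈
      ... | u , u∈ , refl
            with splitAt m u | trans (sym (Vec.lookup-splitAt m h ⁅ i ⁆ u)) (Vec.[]=⇒lookup u∈)
      ...     | inj₁ y | y∈h = x∈p∪q⁺ (inj₁ (∈-image⁺ σ (∈-image⁺ f (Vec.lookup⇒[]= y h y∈h))))
      ...     | inj₂ j | j∈i = x∈p∪q⁺ (inj₂ (subst (λ j → Vec.lookup v j ∈ ⁅ Vec.lookup v i ⁆)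
                (sym (x∈⁅y⁆⇒x≡y i (Vec.lookup⇒[]= j ⁅ i ⁆ j∈i))) (x∈⁅x⁆ (Vec.lookup v i))))

      ∈-image-F : ∀ s → [ Vec.lookup h , Vec.lookup ⁅ i ⁆ ]′ s ≡ inside →
                  g s ∈ image F (h Vec.++ ⁅ i ⁆)
      ∈-image-F s s∈ = subst (λ s → g s ∈ image F (h Vec.++ ⁅ i ⁆)) (Fin.splitAt-join m t s)
        (∈-image⁺ F (Vec.lookup⇒[]= (join m t s) _
          (trans (Vec.lookup-splitAt m h ⁅ i ⁆ (join m t s))
            (trans (cong [ Vec.lookup h , Vec.lookup ⁅ i ⁆ ]′ (Fin.splitAt-join m t s)) s∈))))

      from : ∀ {x} → x ∈ image σ (image f h) ∪ ⁅ Vec.lookup v i ⁆ → x ∈ image F (h Vec.++ ⁅ i ⁆)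
      from x∈ with x∈p∪q⁻ (image σ (image f h)) ⁅ Vec.lookup v i ⁆ x∈
      ... | inj₂ x∈v with refl ← x∈⁅y⁆⇒x≡y _ x∈v =
            ∈-image-F (inj₂ i) (Vec.[]=⇒lookup (x∈⁅x⁆ i))
      ... | inj₁ x∈σ with ∈-image⁻ σ x∈σ
      ...   | y , y∈ , refl with ∈-image⁻ f y∈
      ...     | z , z∈h , refl = ∈-image-F (inj₁ z) (Vec.[]=⇒lookup z∈h)

    F-edges : ∀ {e} → e ∈ₗ edges (K H t) → image F e ∈ₗ edges G
    F-edges e∈ with ∈-cartesianProductWith⁻ (λ h i → h Vec.++ ⁅ i ⁆) (edges H) (allFin t) e∈
    -- The image of `h` belongs to the common link, so each entry of `v` completes it to an edge.
    ... | h , i , h∈H , _ , refl = subst (_∈ₗ edges G) (sym (image-F h i))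
      (VecAll.lookup⁺ (proj₂ (∈-link⁻ (All.lookup f-edges h∈H))) i)

-- The bound for K H t

K-nonempty : ∀ (H : Hypergraph m) t → 1 ≤ size H → 1 ≤ size (K H (suc t))
K-nonempty record { edges = _ ∷ _ } t _ = s≤s z≤n

m≤m^suc[n] : ∀ m n → m ≤ m ^ suc n
m≤m^suc[n] zero    n = z≤n
m≤m^suc[n] (suc m) n = m≤m*n (suc m) (suc m ^ n) {{m^n≢0 (suc m) n}}

module _ {m} (H : Hypergraph m) (d t C n₀ : ℕ)
         (ex-bound : ∀ n → n₀ ≤ n → ex (suc d) H n ≤ C * n ^ d) where

  -- One estimate covers both kinds of tuple: without repeats the link is `H`-free and the first
  -- term suffices; with a repeat the second term dominates the number of all sets of size `suc d`.
  commonLink-bound : ∀ {n} → n₀ + t ≤ n → (G : Hypergraph n) →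
    Uniform (suc (suc d)) G → Free (K H t) G → ∀ v →
    length (commonLink G (suc d) v) ≤ C * n ^ d + repeats v * n ^ suc d
  commonLink-bound {n} n₀+t≤n G uni free v with repeats v in eq
  ... | suc r = begin
    length (commonLink G (suc d) v)        ≤⟨ length-filter _ (layer (suc d) n) ⟩
    length (layer (suc d) n)               ≤⟨ length-layer (suc d) n ⟩
    n ^ suc d                              ≤⟨ m≤m+n _ (r * n ^ suc d) ⟩
    suc r * n ^ suc d                      ≤⟨ m≤n+m _ (C * n ^ d) ⟩
    C * n ^ d + suc r * n ^ suc d          ∎
    where open ≤-Reasoning
  ... | zero = begin
    length (commonLink G (suc d) v)        ≤⟨ length-commonLink≤size G (suc d) v outside-v uni ⟩
    size L                                 ≤⟨ ex-upper (suc d) H L (link-uniform G (suc d) v outside-v)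
                                                (link-free G (suc d) v outside-v (repeats≡0⇒unique v eq) {H} free) ⟩
    -- The complement has lost at most `t` vertices, so `order` is still at least `n₀`.
    ex (suc d) H order                     ≤⟨ ex-bound order (+-cancelʳ-≤ t n₀ order (≤-trans n₀+t≤n n≤order+t)) ⟩
    C * order ^ d                          ≤⟨ *-monoʳ-≤ C (^-monoˡ-≤ d order≤n) ⟩
    C * n ^ d                              ≤⟨ m≤m+n _ 0 ⟩
    C * n ^ d + 0                          ∎
    where
    open ≤-Reasoning
    outside-v : Complement (Vec.lookup v)
    outside-v = complement (Vec.lookup v)
    open Complement outside-v
    L = linkHypergraph G (suc d) v outside-v

-- Here `suc d` and `suc t` are the d and t of the theorem. Tuples with distinct entries and tuples
-- with repeats contribute the same power of n, so their coefficients `C` and `t * t` simply add.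
size-bound : ∀ {m} (H : Hypergraph m) (d t C n₀ : ℕ) →
  (∀ n → n₀ ≤ n → ex (suc d) H n ≤ C * n ^ d) →
  ∀ {n} → n₀ + suc t ≤ n → (G : Hypergraph n) →
  Uniform (suc (suc d)) G → Free (K H (suc t)) G →
  size G ^ suc t ≤ (C + t * t) * n ^ (suc t * suc (suc d) ∸ 1)
size-bound H d t C n₀ ex-bound {n} n≥ G uni free = begin
  size G ^ suc t
    ≤⟨ ^-monoˡ-≤ (suc t) (size≤incidences G (suc d) uni) ⟩
  (∑[ e ← layer (suc d) n ] ∑[ x ← allFin n ] ind (completes? G e x)) ^ suc t
    ≤⟨ incidences-^ (completes? G) t (layer (suc d) n) (allFin n) ⟩
  length (layer (suc d) n) ^ t * ∑[ v ← T ] length (commonLink G (suc d) v)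
    ≤⟨ *-mono-≤ (^-monoˡ-≤ t (length-layer (suc d) n))
         (∑-mono T (λ {v} _ → commonLink-bound H d (suc t) C n₀ ex-bound n≥ G uni free v)) ⟩
  (n ^ suc d) ^ t * ∑[ v ← T ] (C * n ^ d + repeats v * n ^ suc d)
    ≡⟨ cong ((n ^ suc d) ^ t *_) (trans (∑-distrib-+ _ _ T)
         (cong₂ _+_ (∑-const T (C * n ^ d)) (sym (∑-*ʳ (n ^ suc d) repeats T)))) ⟩
  (n ^ suc d) ^ t * (length T * (C * n ^ d) + ∑ T repeats * n ^ suc d)
    ≤⟨ *-monoʳ-≤ ((n ^ suc d) ^ t) (+-mono-≤
         (*-monoˡ-≤ (C * n ^ d) (≤-reflexive (trans (length-tuples (suc t) (allFin n)) (cong (_^ suc t) (length-allFin n)))))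
         (*-monoˡ-≤ (n ^ suc d) (∑-repeats n t))) ⟩
  (n ^ suc d) ^ t * (n ^ suc t * (C * n ^ d) + t * t * n ^ t * n ^ suc d)
    ≡⟨ collect ((n ^ suc d) ^ t) n (n ^ t) (n ^ d) C (t * t) ⟩
  (C + t * t) * (n ^ suc d * ((n ^ suc d) ^ t * n ^ t))
    ≡⟨ cong ((C + t * t) *_) powers ⟩
  (C + t * t) * n ^ (suc t * suc (suc d) ∸ 1)
    ∎
  where
  open ≤-Reasoning
  T = tuples (suc t) (allFin n)

  collect : ∀ a n p q C s → a * (n * p * (C * q) + s * p * (n * q)) ≡ (C + s) * (n * q * (a * p))
  collect = solve-∀

  exponent : ∀ d t → d + (d * t + t) ≡ d + t * suc d
  exponent = solve-∀

  powers : n ^ suc d * ((n ^ suc d) ^ t * n ^ t) ≡ n ^ (suc d + t * suc (suc d))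
  powers = begin-equality
    n ^ suc d * ((n ^ suc d) ^ t * n ^ t) ≡⟨ cong (λ p → n ^ suc d * (p * n ^ t)) (^-*-assoc n (suc d) t) ⟩
    n ^ suc d * (n ^ (suc d * t) * n ^ t) ≡⟨ cong (n ^ suc d *_) (^-distribˡ-+-* n (suc d * t) t) ⟨
    n ^ suc d * n ^ (suc d * t + t)       ≡⟨ ^-distribˡ-+-* n (suc d) (suc d * t + t) ⟨
    n ^ (suc d + (suc d * t + t))         ≡⟨ cong (n ^_) (exponent (suc d) t) ⟩
    n ^ (suc d + t * suc (suc d))         ∎

mainTheorem2 : ∀ (d t : ℕ) → 1 ≤ d → 2 ≤ t →
    ∀ {m : ℕ} (H : Hypergraph m) → Uniform d H → 2 ≤ size H →
    ex d H =O[n^ (d ∸ 1) / 1 ] →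
    ex (suc d) (K H t) =O[n^ (t * suc d ∸ 1) / t ]
mainTheorem2 (suc d) (suc t) _ _ H _ 2≤H (C , n₀ , bound) =
  -- The shift by `suc t` pays for the vertices of the tuple. An extremal hypergraph exists because
  -- `K H (suc t)` has an edge.
  C + t * t , n₀ + suc t , λ n n≥ → bound′ n n≥ (ex-attained (suc (suc d)) (K H (suc t)) n
    (K-nonempty H t (≤-trans (s≤s z≤n) 2≤H)))
  where
  open ≤-Reasoning

  ex-bound : ∀ n → n₀ ≤ n → ex (suc d) H n ≤ C * n ^ d
  ex-bound n n≥ = subst₂ (λ x y → x ≤ y * n ^ d) (^-identityʳ _) (^-identityʳ C) (bound n n≥)

  bound′ : ∀ n → n₀ + suc t ≤ n →
    ∃[ G ] (Uniform {n} (suc (suc d)) G × Free (K H (suc t)) G × size G ≡ ex (suc (suc d)) (K H (suc t)) n) →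
    ex (suc (suc d)) (K H (suc t)) n ^ suc t ≤ (C + t * t) ^ suc t * n ^ (suc t * suc (suc d) ∸ 1)
  bound′ n n≥ (G , uni , free , size≡ex) = begin
    ex (suc (suc d)) (K H (suc t)) n ^ suc t
      ≡⟨ cong (_^ suc t) size≡ex ⟨
    size G ^ suc t
      ≤⟨ size-bound H d t C n₀ ex-bound n≥ G uni free ⟩
    (C + t * t) * n ^ (suc t * suc (suc d) ∸ 1)
      -- The O-notation raises its constant to the power `suc t`, which does not decrease a natural
      -- number.
      ≤⟨ *-monoˡ-≤ (n ^ (suc t * suc (suc d) ∸ 1)) (m≤m^suc[n] (C + t * t) t) ⟩
    (C + t * t) ^ suc t * n ^ (suc t * suc (suc d) ∸ 1)
      ∎
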